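{- Let $n\ge 0$, let $X\subseteq\{0,1\}^n$, and let $G=Q_n(X)$ be the daisy cube generated by $X$. Then for every vertex $u$ of $G$, $$D_{G,u}(x,-x)=1$$ as polynomials in $x$, where $D_{G,u}(x,y)$ is the distance cube polynomial of $G$ with respect to $u$.
   Context: The $n$-cube $Q_n$ is the graph with vertex set $\{0,1\}^n$, two words being adjacent if they differ in exactly one coordinate ($Q_0=K_1$). For $u,v\in\{0,1\}^n$ write $u\le v$ if $u_i\le v_i$ for all $i$. For $X\subseteq\{0,1\}^n$, the daisy cube $Q_n(X)$ generated by $X$ is the subgraph of $Q_n$ induced by $\{u\in\{0,1\}^n : u\le x \text{ for some } x\in X\}$. For a finite graph $G$, $u\in V(G)$ and a subgraph $H$ of $G$, $d(u,H)=\min_{v\in V(H)}d_G(u,v)$. Let $c_{k,d}(G)$ ($k,d\ge 0$) be the number of induced subgraphs $H$ of $G$ isomorphic to $Q_k$ with $d(u,H)=d$. The distance cube polynomial of $G$ with respect to $u$ is $D_{G,u}(x,y)=\sum_{k,d\ge0}c_{k,d}(G)x^ky^d$. -}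

module Defs where

open import Data.Bool.Base as Bool using (Bool; true; false)
import Data.Bool.Properties as Bool
open import Data.Fin.Base using (Fin; finToFun; funToFin)
import Data.Fin.Properties as Fin
open import Data.Integer.Base as ℤ using (ℤ; +_; 0ℤ; 1ℤ)
open import Data.List.Base as List
  using (List; []; _∷_; _++_; length; filter; upTo)
import Data.List.Membership.DecPropositional as DecMembership
open import Data.List.Membership.Propositional using (_∈_; find; lose)
open import Data.List.Membership.Propositional.Properties
  using (∈-map⁺; ∈-map⁻; ∈-++⁺ˡ; ∈-++⁺ʳ)
import Data.List.Relation.Unary.All as All
import Data.List.Relation.Unary.Any as Any
open import Data.List.Relation.Unary.Any using (here)
open import Data.List.Relation.Unary.Unique.Propositional using (Unique)
import Data.List.Relation.Unary.AllPairs as AllPairs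
import Data.List.Relation.Unary.Unique.Propositional.Properties as Unique
open import Data.Nat.Base as ℕ using (ℕ; zero; suc; _<_; _≤_)
import Data.Nat.Properties as ℕ
open import Data.Product using (∃; ∃-syntax; ∃!; _×_; _,_)
open import Data.Vec.Base as Vec using (Vec; []; _∷_; lookup)
import Data.Vec.Properties as Vec
open import Data.Vec.Relation.Binary.Pointwise.Inductive as Pointwise using (Pointwise)
open import Function.Base using (_∘_)
open import Function.Bundles
  using (_⤖_; mk⤖; _⇔_; mk⇔; module Bijection; module Equivalence)
open import Function.Consequences.Propositional using (strictlySurjective⇒surjective)
open import Level using (0ℓ)
open import Relation.Binary.Core using (Rel)
open import Relation.Binary.Definitions
  using (DecidableEquality; Symmetric; Irreflexive) renaming (Decidable to Decidable₂)
open import Relation.Binary.PropositionalEquality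
  using (_≡_; _≢_; refl; sym; trans; ≢-sym; _≗_)
open import Relation.Nullary.Decidable
  using (Dec; map′; _×-dec_; _→-dec_; ¬?)
open import Relation.Nullary.Negation using (¬_)
open import Relation.Unary using (Pred; Decidable)

------------------------------------------------------------------------
-- Finite simple graphs

-- The vertex set is the set of entries of `vertices`; elements of `Carrier`
-- outside that list are not vertices, whatever `Adj` says about them.

record FiniteGraph : Set₁ where
  field
    Carrier  : Set
    _≟_      : DecidableEquality Carrier
    vertices : List Carrier
    unique   : Unique vertices
    Adj      : Rel Carrier 0ℓ
    adj?     : Decidable₂ Adj
    symm     : Symmetric Adj
    irrefl   : Irreflexive _≡_ Adj

  order : ℕ
  order = length vertices

  vertex : Fin order → Carrier
  vertex = List.lookup vertices

open FiniteGraph public using (vertices)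

induced : (G : FiniteGraph) {P : Pred (FiniteGraph.Carrier G) 0ℓ} →
          Decidable P → FiniteGraph
induced G P? = record
  { FiniteGraph G hiding (vertices; unique)
  ; vertices = filter P? (vertices G)
  ; unique   = Unique.filter⁺ P? (FiniteGraph.unique G)
  }

infix 4 _≅_ _≅?_

record _≅_ (G H : FiniteGraph) : Set where
  private
    module G = FiniteGraph G
    module H = FiniteGraph H
  field
    bijection : Fin G.order ⤖ Fin H.order
  open Bijection bijection public using (to)
  field
    adjacency : ∀ i j → G.Adj (G.vertex i) (G.vertex j) ⇔
                        H.Adj (H.vertex (to i)) (H.vertex (to j))

_≅?_ : ∀ G H → Dec (G ≅ H)
G ≅? H = map′ fromCode toCode (Fin.any? λ c → iso? (finToFun c))
  where
  module G = FiniteGraph G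
  module H = FiniteGraph H

  IsIso : (Fin G.order → Fin H.order) → Set
  IsIso f = (∀ i j → f i ≡ f j → i ≡ j) × (∀ y → ∃[ i ] f i ≡ y) ×
            (∀ i j → (G.Adj (G.vertex i) (G.vertex j) →
                      H.Adj (H.vertex (f i)) (H.vertex (f j))) ×
                     (H.Adj (H.vertex (f i)) (H.vertex (f j)) →
                      G.Adj (G.vertex i) (G.vertex j)))

  iso? : ∀ f → Dec (IsIso f)
  iso? f =
    Fin.all? (λ i → Fin.all? λ j → (f i Fin.≟ f j) →-dec (i Fin.≟ j)) ×-dec
    Fin.all? (λ y → Fin.any? λ i → f i Fin.≟ y) ×-dec
    Fin.all? (λ i → Fin.all? λ j →
      let g? = G.adj? (G.vertex i) (G.vertex j)
          h? = H.adj? (H.vertex (f i)) (H.vertex (f j))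
      in (g? →-dec h?) ×-dec (h? →-dec g?))

  fromCode : ∃ (IsIso ∘ finToFun) → G ≅ H
  fromCode (_ , inj , sur , adj) = record
    { bijection = mk⤖ ((λ {i} {j} → inj i j) , strictlySurjective⇒surjective sur)
    ; adjacency = λ i j → let (g→h , h→g) = adj i j in mk⇔ g→h h→g
    }

  resp : ∀ {f g} → f ≗ g → IsIso f → IsIso g
  resp f≗g (inj , sur , adj) =
    (λ i j eq → inj i j (trans (f≗g i) (trans eq (sym (f≗g j))))) ,
    (λ y → let (i , eq) = sur y in i , trans (sym (f≗g i)) eq) ,
    λ i j → adj′ i j (f≗g i) (f≗g j) (adj i j)
    where
    adj′ : ∀ i j {a a′ b b′} → a ≡ a′ → b ≡ b′ →
      (G.Adj (G.vertex i) (G.vertex j) → H.Adj (H.vertex a) (H.vertex b)) ×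
      (H.Adj (H.vertex a) (H.vertex b) → G.Adj (G.vertex i) (G.vertex j)) →
      (G.Adj (G.vertex i) (G.vertex j) → H.Adj (H.vertex a′) (H.vertex b′)) ×
      (H.Adj (H.vertex a′) (H.vertex b′) → G.Adj (G.vertex i) (G.vertex j))
    adj′ _ _ refl refl p = p

  toCode : G ≅ H → ∃ (IsIso ∘ finToFun)
  toCode iso = funToFin to , resp (sym ∘ Fin.finToFun-funToFin to)
    ( (λ _ _ → injective)
    , (λ y → let (i , eq) = surjective y in i , eq refl)
    , λ i j → Equivalence.to (adjacency i j) , Equivalence.from (adjacency i j) )
    where
    open _≅_ iso
    open Bijection bijection using (injective; surjective)

------------------------------------------------------------------------
-- Distances

module _ (G : FiniteGraph) where
  open FiniteGraph G using (Carrier; _≟_; Adj; adj?)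

  data Walk : Carrier → Carrier → ℕ → Set where
    [_]     : ∀ {u} → u ∈ vertices G → Walk u u 0
    _∷⟨_⟩_ : ∀ {u w v l} → u ∈ vertices G → Adj u w → Walk w v l → Walk u v (suc l)

  -- d_G(u,v) = d.  A shortest walk is a shortest path; vertices in different
  -- components have no distance.
  IsDistance : Carrier → Carrier → ℕ → Set
  IsDistance u v d = Walk u v d × (∀ {e} → e < d → ¬ Walk u v e)

  -- min { d_G(u,v) : v ∈ vs } = d
  IsMinDistance : Carrier → List Carrier → ℕ → Set
  IsMinDistance u vs d =
    (∃[ v ] v ∈ vs × IsDistance u v d) ×
    (∀ {v e} → v ∈ vs → IsDistance u v e → d ≤ e)

  private
    open DecMembership _≟_ using (_∈?_)

    source : ∀ {u v l} → Walk u v l → u ∈ vertices G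
    source [ u∈ ]           = u∈
    source (u∈ ∷⟨ _ ⟩ _) = u∈

  walk? : ∀ u v l → Dec (Walk u v l)
  walk? u v zero = map′ (λ { (u∈ , refl) → [ u∈ ] }) (λ { [ u∈ ] → u∈ , refl })
    ((u ∈? vertices G) ×-dec (u ≟ v))
  walk? u v (suc l) = map′ join split
    ((u ∈? vertices G) ×-dec Any.any? step? (vertices G))
    where
    Step : Pred Carrier 0ℓ
    Step w = Adj u w × Walk w v l

    step? : Decidable Step
    step? w = adj? u w ×-dec walk? w v l

    join : u ∈ vertices G × Any.Any Step (vertices G) → Walk u v (suc l)
    join (u∈ , p) with find p
    ... | _ , _ , a , ws = u∈ ∷⟨ a ⟩ ws

    split : Walk u v (suc l) → u ∈ vertices G × Any.Any Step (vertices G)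
    split (u∈ ∷⟨ a ⟩ ws) = u∈ , lose (source ws) (a , ws)

  isDistance? : ∀ u v d → Dec (IsDistance u v d)
  isDistance? u v d = walk? u v d ×-dec ℕ.allUpTo? (λ e → ¬? (walk? u v e)) d

  isMinDistance? : ∀ u vs d → Dec (IsMinDistance u vs d)
  isMinDistance? u vs d =
    map′ (λ p → let (v , v∈ , q) = find p in v , v∈ , q)
         (λ (_ , v∈ , q) → lose v∈ q)
         (Any.any? (λ v → isDistance? u v d) vs)
    ×-dec
    map′ below⇒bound bound⇒below
         (All.all? (λ v → ℕ.allUpTo? (λ e → ¬? (isDistance? u v e)) d) vs)
    where
    NoneBelow : Pred Carrier 0ℓ
    NoneBelow v = ∀ {e} → e < d → ¬ IsDistance u v e

    below⇒bound : All.All NoneBelow vs →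
                  ∀ {v e} → v ∈ vs → IsDistance u v e → d ≤ e
    below⇒bound h v∈ q = ℕ.≮⇒≥ λ e<d → All.lookup h v∈ e<d q

    bound⇒below : (∀ {v e} → v ∈ vs → IsDistance u v e → d ≤ e) →
                  All.All NoneBelow vs
    bound⇒below h = All.tabulate λ v∈ e<d q → ℕ.<⇒≱ e<d (h v∈ q)

------------------------------------------------------------------------
-- Hypercubes and daisy cubes

Word : ℕ → Set
Word = Vec Bool

words : ∀ n → List (Word n)
words zero    = [] ∷ []
words (suc n) = List.map (false ∷_) (words n) ++ List.map (true ∷_) (words n)

∈-words : ∀ {n} (w : Word n) → w ∈ words n
∈-words []          = here refl
∈-words (false ∷ w) = ∈-++⁺ˡ (∈-map⁺ (false ∷_) (∈-words w))
∈-words (true  ∷ w) = ∈-++⁺ʳ _ (∈-map⁺ (true ∷_) (∈-words w))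

words-unique : ∀ n → Unique (words n)
words-unique zero    = All.[] AllPairs.∷ AllPairs.[]
words-unique (suc n) = Unique.++⁺
  (Unique.map⁺ Vec.∷-injectiveʳ (words-unique n))
  (Unique.map⁺ Vec.∷-injectiveʳ (words-unique n))
  λ (p , q) → disjoint (∈-map⁻ (false ∷_) p) (∈-map⁻ (true ∷_) q)
  where
  disjoint : ∀ {w} → ∃[ x ] x ∈ words n × w ≡ false ∷ x →
             ¬ (∃[ y ] y ∈ words n × w ≡ true ∷ y)
  disjoint (_ , _ , refl) (_ , _ , ())

DifferInOne : ∀ {n} → Rel (Word n) 0ℓ
DifferInOne u v = ∃! _≡_ λ i → lookup u i ≢ lookup v i

differInOne? : ∀ {n} → Decidable₂ (DifferInOne {n})
differInOne? u v = Fin.any? λ i → differ? i ×-dec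
  map′ (λ h {j} → h j) (λ h j → h {j}) (Fin.all? λ j → differ? j →-dec (i Fin.≟ j))
  where
  differ? : Decidable (λ i → lookup u i ≢ lookup v i)
  differ? i = ¬? (lookup u i Bool.≟ lookup v i)

cube : ℕ → FiniteGraph
cube n = record
  { Carrier  = Word n
  ; _≟_      = Vec.≡-dec Bool._≟_
  ; vertices = words n
  ; unique   = words-unique n
  ; Adj      = DifferInOne
  ; adj?     = differInOne?
  ; symm     = λ (i , i≢ , uniq) → i , ≢-sym i≢ , λ j≢ → uniq (≢-sym j≢)
  ; irrefl   = λ { refl (_ , i≢ , _) → i≢ refl }
  }

infix 4 _≤ʷ_

_≤ʷ_ : ∀ {n} → Rel (Word n) 0ℓ
_≤ʷ_ = Pointwise Bool._≤_

Below : ∀ {n} → Pred (Word n) 0ℓ → Pred (Word n) 0ℓ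
Below X u = ∃[ x ] X x × u ≤ʷ x

below? : ∀ {n} {X : Pred (Word n) 0ℓ} → Decidable X → Decidable (Below X)
below? X? u = map′
  (λ p → let (x , _ , q) = find p in x , q)
  (λ (x , q) → lose (∈-words x) q)
  (Any.any? (λ x → X? x ×-dec Pointwise.decidable Bool._≤?_ u x) (words _))

daisyCube : ∀ {n} {X : Pred (Word n) 0ℓ} → Decidable X → FiniteGraph
daisyCube {n} X? = induced (cube n) (below? X?)

------------------------------------------------------------------------
-- Univariate integer polynomials, as coefficient lists with the constant
-- term first.  Trailing zeros are allowed, so equality is `_≈ₚ_`, not `_≡_`.

Poly : Set
Poly = List ℤ

coeff : Poly → ℕ → ℤ
coeff []      _       = 0ℤ
coeff (a ∷ p) zero    = a
coeff (a ∷ p) (suc m) = coeff p m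

infix  4 _≈ₚ_
infixl 6 _+ₚ_
infixl 7 _*ₚ_
infix  8 -ₚ_

_≈ₚ_ : Rel Poly 0ℓ
p ≈ₚ q = ∀ m → coeff p m ≡ coeff q m

_+ₚ_ : Poly → Poly → Poly
[]      +ₚ q       = q
(a ∷ p) +ₚ []      = a ∷ p
(a ∷ p) +ₚ (b ∷ q) = (a ℤ.+ b) ∷ (p +ₚ q)

-ₚ_ : Poly → Poly
-ₚ p = List.map (λ a → ℤ.- a) p

_*ₚ_ : Poly → Poly → Poly
[]      *ₚ q = []
(a ∷ p) *ₚ q = List.map (a ℤ.*_) q +ₚ (0ℤ ∷ (p *ₚ q))

1ₚ : Poly
1ₚ = 1ℤ ∷ []

xₚ : Poly
xₚ = 0ℤ ∷ 1ℤ ∷ []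

-- Polynomials in y over ℤ[x]: entry d is the coefficient of y^d.

BiPoly : Set
BiPoly = List Poly

infix 9 _[y≔_]

_[y≔_] : BiPoly → Poly → Poly
[]      [y≔ q ] = []
(p ∷ P) [y≔ q ] = p +ₚ q *ₚ P [y≔ q ]

------------------------------------------------------------------------
-- The distance cube polynomial

-- For a duplicate-free list, every subset occurs exactly once.
sublists : ∀ {A : Set} → List A → List (List A)
sublists []       = [] ∷ []
sublists (a ∷ as) = List.map (a ∷_) (sublists as) ++ sublists as

module _ (G : FiniteGraph) where
  open FiniteGraph G using (Carrier; _≟_; order)
  open DecMembership _≟_ using (_∈?_)

  inducedOn : List Carrier → FiniteGraph
  inducedOn S = induced G (_∈? S)

  IsCubeAtDistance : Carrier → ℕ → ℕ → Pred (List Carrier) 0ℓ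
  IsCubeAtDistance u k d S =
    inducedOn S ≅ cube k × IsMinDistance G u (vertices (inducedOn S)) d

  isCubeAtDistance? : ∀ u k d → Decidable (IsCubeAtDistance u k d)
  isCubeAtDistance? u k d S =
    (inducedOn S ≅? cube k) ×-dec isMinDistance? G u (vertices (inducedOn S)) d

  -- An induced subgraph is determined by its vertex set.
  cubeCount : Carrier → ℕ → ℕ → ℕ
  cubeCount u k d = length (filter (isCubeAtDistance? u k d) (sublists (vertices G)))

  -- Exponents run over 0 ≤ k , d < order.  Nothing is lost: a copy of Q_k has
  -- 2^k > k vertices, and a shortest path of length d has d + 1 vertices.
  distanceCubePolynomial : Carrier → BiPoly
  distanceCubePolynomial u =
    List.map (λ d → List.map (λ k → + cubeCount u k d) (upTo order)) (upTo order)

-- An induced k-cube of Q_n is a face, because opposite edges of a 4-cycle flip the same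
-- coordinate; a face lies in the daisy cube iff its top vertex does.  Daisy cubes are
-- isometric in Q_n, so the distance from u to a face is the number of fixed coordinates in
-- which they disagree.  Hence D(x,-x) is the sum over the faces with top in the down-set of
-- a product with one factor per coordinate: x if it is free, 1 if it is fixed and agrees
-- with u, and -x otherwise.  Splitting off the first coordinate gives 1 by induction.

module Submission where

open import Defs
open import Data.Bool.Base as Bool using (Bool; true; false; not; if_then_else_; f≤t; b≤b)
import Data.Bool.Properties as Bool
open import Data.Empty using (⊥-elim)
open import Data.Fin.Base using (Fin; zero; suc; toℕ)
import Data.Fin.Properties as Fin
open import Data.Integer.Base as ℤ using (ℤ; 0ℤ; 1ℤ; -1ℤ) renaming (+_ to pos)
import Data.Integer.Properties as ℤ
open import Data.Integer.Tactic.RingSolver using (solve-∀)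
open import Data.List.Base as List
  using (List; []; _∷_; _++_; length; filter; upTo; applyUpTo)
import Data.List.Properties as List
import Data.List.Membership.DecPropositional as DecMembership
open import Data.List.Membership.Propositional using (_∈_; _∉_)
open import Data.List.Membership.Propositional.Properties
  using (∈-map⁺; ∈-map⁻; ∈-++⁺ˡ; ∈-++⁺ʳ; ∈-++⁻; ∈-filter⁺; ∈-filter⁻; ∈-lookup)
open import Data.List.Membership.Propositional.Properties.WithK using (unique∧set⇒bag)
open import Data.List.Relation.Binary.BagAndSetEquality using (∼bag⇒↭)
open import Data.List.Relation.Binary.Permutation.Propositional.Properties using (↭-length)
open import Data.List.Relation.Unary.All as All using (All; []; _∷_)
open import Data.List.Relation.Unary.AllPairs using ([]; _∷_)
open import Data.List.Relation.Unary.Any using (here; there; index)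
open import Data.List.Relation.Unary.Any.Properties using (lookup-index)
open import Data.List.Relation.Unary.Unique.Propositional using (Unique)
import Data.List.Relation.Unary.Unique.Propositional.Properties as Unique
open import Data.Maybe.Base using (Maybe; just; nothing; fromMaybe)
open import Data.Nat.Base using (ℕ; zero; suc; _+_; _≤_; _<_; z≤n; s≤s)
import Data.Nat.Properties as ℕ
open import Data.Product using (∃-syntax; _×_; _,_; proj₁; proj₂)
open import Data.Sum.Base using (_⊎_; inj₁; inj₂)
open import Data.Vec.Base as Vec using (Vec; []; _∷_; lookup; updateAt; zipWith; replicate)
import Data.Vec.Properties as Vec
open import Data.Vec.Relation.Binary.Pointwise.Extensional using (ext; extensional⇒inductive)
open import Data.Vec.Relation.Binary.Pointwise.Inductive as Pointwise
  using (Pointwise; []; _∷_; Pointwise-≡⇒≡)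
open import Function.Base using (_∘_; id)
open import Function.Bundles
  using (_⇔_; mk⇔; mk⤖; module Bijection; module Equivalence)
open import Function.Consequences.Propositional using (strictlySurjective⇒surjective)
open import Function.Definitions using (Injective)
open import Level using (0ℓ)
open import Relation.Binary.PropositionalEquality
  using (_≡_; _≢_; refl; sym; trans; cong; cong₂; subst; module ≡-Reasoning)
open import Relation.Nullary.Decidable
  using (Dec; yes; no; does; _×-dec_; map′; decidable-stable)
open import Relation.Nullary.Negation using (¬_; contradiction)
open import Relation.Unary using (Pred; Decidable)

-- The claim is proved for decidable down-sets, not for generators: both slices of a down-set along
-- the first coordinate are down-sets again, so the induction needs no generators of the slices.
--
-- Isometry holds because a shortest path in Q_n can lower coordinates before it raises any; every
-- word on it is then below one of the two ends.
--
-- Two features of the definitions shape the rest. Cubes are counted as sublists of the vertex list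
-- and up to abstract isomorphism, while the signed sum runs over faces; so vertex sets and faces
-- have to correspond one to one as lists. And the polynomial is cut off at exponents below the
-- order of the graph, so the dimension of a face and its distance from u must be shown to stay
-- below that order. Both are Hamming distances between vertices of G, and a shortest path of length
-- d visits d + 1 of them.

private
  variable
    A B : Set
    n : ℕ

-- Words and the Hamming distance

flip : Fin n → Word n → Word n
flip i w = updateAt w i not

flip-involutive : ∀ (i : Fin n) w → flip i (flip i w) ≡ w
flip-involutive zero    (a ∷ w) = cong (_∷ w) (Bool.not-involutive a)
flip-involutive (suc i) (a ∷ w) = cong (a ∷_) (flip-involutive i w)

lookup-flip : ∀ (i : Fin n) w → lookup (flip i w) i ≢ lookup w i
lookup-flip i w eq = Bool.not-¬ refl (trans (sym eq) (Vec.lookup∘updateAt i w))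

lookup-flip-≢ : ∀ {i j : Fin n} → j ≢ i → ∀ w → lookup (flip i w) j ≡ lookup w j
lookup-flip-≢ {i = i} {j} j≢i w = Vec.lookup∘updateAt′ j i j≢i w

differInOne⇒flip : ∀ {u v : Word n} → DifferInOne u v → ∃[ i ] v ≡ flip i u
differInOne⇒flip {u = u} {v} (i , u≢v , uniq) =
  i , Pointwise-≡⇒≡ (extensional⇒inductive (ext agree))
  where
  agree : ∀ j → lookup v j ≡ lookup (flip i u) j
  agree j with j Fin.≟ i
  ... | yes refl = trans (Bool.¬-not (u≢v ∘ sym)) (sym (Vec.lookup∘updateAt i u))
  ... | no j≢i = trans
    (sym (decidable-stable (lookup u j Bool.≟ lookup v j) (j≢i ∘ sym ∘ uniq)))
    (sym (lookup-flip-≢ j≢i u))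

flip⇒differInOne : ∀ i (u : Word n) → DifferInOne u (flip i u)
flip⇒differInOne i u = i , lookup-flip i u ∘ sym ,
  λ {j} u≢ → decidable-stable (i Fin.≟ j)
    λ i≢j → u≢ (sym (lookup-flip-≢ (i≢j ∘ sym) u))

mismatch : Bool → Bool → ℕ
mismatch false false = 0
mismatch false true  = 1
mismatch true  false = 1
mismatch true  true  = 0

mismatch-refl : ∀ a → mismatch a a ≡ 0
mismatch-refl false = refl
mismatch-refl true  = refl

mismatch-not : ∀ a → mismatch a (not a) ≡ 1
mismatch-not false = refl
mismatch-not true  = refl

ham : Word n → Word n → ℕ
ham []      []      = 0
ham (a ∷ u) (b ∷ v) = mismatch a b + ham u v

ham-refl : (u : Word n) → ham u u ≡ 0
ham-refl []      = refl
ham-refl (a ∷ u) = cong₂ _+_ (mismatch-refl a) (ham-refl u)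

ham≡0⇒≡ : (u v : Word n) → ham u v ≡ 0 → u ≡ v
ham≡0⇒≡ []          []          _  = refl
ham≡0⇒≡ (false ∷ u) (false ∷ v) eq = cong (false ∷_) (ham≡0⇒≡ u v eq)
ham≡0⇒≡ (true  ∷ u) (true  ∷ v) eq = cong (true ∷_) (ham≡0⇒≡ u v eq)

ham-flip : ∀ i (u : Word n) → ham u (flip i u) ≡ 1
ham-flip zero    (a ∷ u) = cong₂ _+_ (mismatch-not a) (ham-refl u)
ham-flip (suc i) (a ∷ u) = cong₂ _+_ (mismatch-refl a) (ham-flip i u)

ham≡1⇒flip : (u v : Word n) → ham u v ≡ 1 → ∃[ i ] v ≡ flip i u
ham≡1⇒flip []          []          ()
ham≡1⇒flip (false ∷ u) (false ∷ v) eq with ham≡1⇒flip u v eq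
... | i , refl = suc i , refl
ham≡1⇒flip (true  ∷ u) (true  ∷ v) eq with ham≡1⇒flip u v eq
... | i , refl = suc i , refl
ham≡1⇒flip (false ∷ u) (true  ∷ v) eq with refl ← ham≡0⇒≡ u v (ℕ.suc-injective eq) =
  zero , refl
ham≡1⇒flip (true  ∷ u) (false ∷ v) eq with refl ← ham≡0⇒≡ u v (ℕ.suc-injective eq) =
  zero , refl

differInOne⇒ham≡1 : (u v : Word n) → DifferInOne u v → ham u v ≡ 1
differInOne⇒ham≡1 u v adj with differInOne⇒flip {u = u} {v} adj
... | i , refl = ham-flip i u

ham≡1⇒differInOne : (u v : Word n) → ham u v ≡ 1 → DifferInOne u v
ham≡1⇒differInOne u v eq with ham≡1⇒flip u v eq
... | i , refl = flip⇒differInOne i u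

mismatch-triangle : ∀ a b → mismatch a b ≤ suc (mismatch (not a) b)
mismatch-triangle false false = z≤n
mismatch-triangle false true  = s≤s z≤n
mismatch-triangle true  false = s≤s z≤n
mismatch-triangle true  true  = z≤n

ham-flipˡ : ∀ i (u v : Word n) → ham u v ≤ suc (ham (flip i u) v)
ham-flipˡ zero    (a ∷ u) (b ∷ v) = ℕ.+-monoˡ-≤ (ham u v) (mismatch-triangle a b)
ham-flipˡ (suc i) (a ∷ u) (b ∷ v) = ℕ.≤-trans
  (ℕ.+-monoʳ-≤ (mismatch a b) (ham-flipˡ i u v))
  (ℕ.≤-reflexive (ℕ.+-suc (mismatch a b) _))

≤ʷ-refl : {u : Word n} → u ≤ʷ u
≤ʷ-refl = Pointwise.refl b≤b

-- The last component is what keeps a geodesic inside a down-set. A coordinate with 1 in `u` and 0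
-- in `v` is lowered, giving a word below `u`; if there is none, then `u ≤ʷ v` and raising a
-- differing coordinate stays below `v`.
ham-step : ∀ {d} (u v : Word n) → ham u v ≡ suc d →
           ∃[ w ] DifferInOne u w × ham w v ≡ d × (w ≤ʷ u ⊎ w ≤ʷ v)
ham-step u v eq = let i , h , le = go u v eq in flip i u , flip⇒differInOne i u , h , le
  where
  go : ∀ {n d} (u v : Word n) → ham u v ≡ suc d →
       ∃[ i ] ham (flip i u) v ≡ d × (flip i u ≤ʷ u ⊎ flip i u ≤ʷ v)
  go []          []          ()
  go (false ∷ u) (false ∷ v) eq with go u v eq
  ... | i , h , inj₁ le = suc i , h , inj₁ (b≤b ∷ le)
  ... | i , h , inj₂ le = suc i , h , inj₂ (b≤b ∷ le)
  go (true ∷ u) (true ∷ v) eq with go u v eq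
  ... | i , h , inj₁ le = suc i , h , inj₁ (b≤b ∷ le)
  ... | i , h , inj₂ le = suc i , h , inj₂ (b≤b ∷ le)
  go (true ∷ u) (false ∷ v) eq = zero , ℕ.suc-injective eq , inj₁ (f≤t ∷ ≤ʷ-refl)
  -- Raising this coordinate waits until the tails agree: before that, the tail of `u` may have a 1
  -- where `v` has a 0, and the raised word would lie below neither end.
  go (false ∷ u) (true ∷ v) eq with ham u v in eq′
  ... | zero with refl ← ham≡0⇒≡ u v eq′ =
    zero , trans eq′ (ℕ.suc-injective eq) , inj₂ ≤ʷ-refl
  ... | suc _ with go u v eq′
  ...   | i , h , inj₁ le = suc i , trans (cong suc h) (ℕ.suc-injective eq) , inj₁ (b≤b ∷ le)
  ...   | i , h , inj₂ le = suc i , trans (cong suc h) (ℕ.suc-injective eq) , inj₂ (f≤t ∷ le)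

-- Faces of the cube

-- The free coordinates of a face are the entries `nothing`.
Face : ℕ → Set
Face = Vec (Maybe Bool)

data Matches : Bool → Maybe Bool → Set where
  fixed : ∀ {b} → Matches b (just b)
  free  : ∀ {b} → Matches b nothing

matches? : ∀ a c → Dec (Matches a c)
matches? a nothing  = yes free
matches? a (just b) = map′ (λ { refl → fixed }) (λ { fixed → refl }) (a Bool.≟ b)

infix 4 _∈ᶠ_ _∈ᶠ?_

_∈ᶠ_ : Word n → Face n → Set
_∈ᶠ_ = Pointwise Matches

_∈ᶠ?_ : ∀ (w : Word n) p → Dec (w ∈ᶠ p)
_∈ᶠ?_ = Pointwise.decidable matches?

dim : Face n → ℕ
dim []            = 0
dim (just _  ∷ p) = dim p
dim (nothing ∷ p) = suc (dim p)

dist : Word n → Face n → ℕ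
dist []      []            = 0
dist (a ∷ u) (just b  ∷ p) = mismatch a b + dist u p
dist (a ∷ u) (nothing ∷ p) = dist u p

-- The gate of `u` in the face: free coordinates are copied from `u`. The extreme vertices `top` and
-- `bottom` are the gates of the constant words, so `nearest-∈` covers them as well.
nearest : Word n → Face n → Word n
nearest = zipWith fromMaybe

top bottom : Face n → Word n
top    = nearest (replicate _ true)
bottom = nearest (replicate _ false)

nearest-∈ : ∀ (u : Word n) p → nearest u p ∈ᶠ p
nearest-∈ []      []            = []
nearest-∈ (a ∷ u) (just b  ∷ p) = fixed ∷ nearest-∈ u p
nearest-∈ (a ∷ u) (nothing ∷ p) = free ∷ nearest-∈ u p

ham-nearest : ∀ (u : Word n) p → ham u (nearest u p) ≡ dist u p
ham-nearest []      []            = refl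
ham-nearest (a ∷ u) (just b  ∷ p) = cong (_ +_) (ham-nearest u p)
ham-nearest (a ∷ u) (nothing ∷ p) = cong₂ _+_ (mismatch-refl a) (ham-nearest u p)

dist≤ham : ∀ (u : Word n) {v p} → v ∈ᶠ p → dist u p ≤ ham u v
dist≤ham []      []           = z≤n
dist≤ham (a ∷ u) (fixed ∷ v∈) = ℕ.+-monoʳ-≤ (mismatch a _) (dist≤ham u v∈)
dist≤ham (a ∷ u) (free  ∷ v∈) = ℕ.≤-trans (dist≤ham u v∈) (ℕ.m≤n+m _ (mismatch a _))

-- Exhibits the dimension as a distance between two vertices of the face, so that a bound on
-- distances also bounds dimensions.
ham-bottom-top : (p : Face n) → ham (bottom p) (top p) ≡ dim p
ham-bottom-top []            = refl
ham-bottom-top (just b  ∷ p) = cong₂ _+_ (mismatch-refl b) (ham-bottom-top p)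
ham-bottom-top (nothing ∷ p) = cong suc (ham-bottom-top p)

∈⇒≤top : ∀ {w : Word n} {p} → w ∈ᶠ p → w ≤ʷ top p
∈⇒≤top []           = []
∈⇒≤top (fixed ∷ w∈) = b≤b ∷ ∈⇒≤top w∈
∈⇒≤top (free  ∷ w∈) = Bool.≤-maximum _ ∷ ∈⇒≤top w∈

-- No face is empty, so a word matching the tail can always be completed at the head and conversely.
-- The first entry is then read off from the bits that occur there: both bits for a free entry, only
-- one for a fixed entry.
∈ᶠ-injective : (p q : Face n) → (∀ w → w ∈ᶠ p ⇔ w ∈ᶠ q) → p ≡ q
∈ᶠ-injective []      []      _ = refl
∈ᶠ-injective {suc n} (c ∷ p) (e ∷ q) h =
  cong₂ _∷_ (head≡ c e same-head)
    (∈ᶠ-injective p q λ w → mk⇔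
      (λ w∈ → Pointwise.tail (Equivalence.to (h _) (proj₂ (head-∈ c) ∷ w∈)))
      (λ w∈ → Pointwise.tail (Equivalence.from (h _) (proj₂ (head-∈ e) ∷ w∈))))
  where
  head-∈ : ∀ c → ∃[ a ] Matches a c
  head-∈ (just b) = b , fixed
  head-∈ nothing  = true , free

  z : Word n
  z = replicate _ true

  same-head : ∀ a → Matches a c ⇔ Matches a e
  same-head a = mk⇔
    (λ m → Pointwise.head (Equivalence.to (h _) (m ∷ nearest-∈ z p)))
    (λ m → Pointwise.head (Equivalence.from (h _) (m ∷ nearest-∈ z q)))

  head≡ : ∀ c e → (∀ a → Matches a c ⇔ Matches a e) → c ≡ e
  head≡ (just b) (just b′) m with fixed ← Equivalence.to (m b) fixed = refl
  head≡ nothing  nothing   _ = refl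
  head≡ nothing  (just b)  m with Equivalence.to (m false) free | Equivalence.to (m true) free
  ... | fixed | ()
  head≡ (just b) nothing   m with Equivalence.from (m false) free | Equivalence.from (m true) free
  ... | fixed | ()

embed : (p : Face n) → Word (dim p) → Word n
embed []            w       = []
embed (just b  ∷ p) w       = b ∷ embed p w
embed (nothing ∷ p) (a ∷ w) = a ∷ embed p w

project : (p : Face n) → Word n → Word (dim p)
project []            []      = []
project (just b  ∷ p) (a ∷ w) = project p w
project (nothing ∷ p) (a ∷ w) = a ∷ project p w

embed-∈ : ∀ (p : Face n) w → embed p w ∈ᶠ p
embed-∈ []            w       = []
embed-∈ (just b  ∷ p) w       = fixed ∷ embed-∈ p w
embed-∈ (nothing ∷ p) (a ∷ w) = free ∷ embed-∈ p w

project-embed : ∀ (p : Face n) w → project p (embed p w) ≡ w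
project-embed []            []      = refl
project-embed (just b  ∷ p) w       = project-embed p w
project-embed (nothing ∷ p) (a ∷ w) = cong (a ∷_) (project-embed p w)

embed-project : ∀ {p : Face n} {w} → w ∈ᶠ p → embed p (project p w) ≡ w
embed-project []           = refl
embed-project (fixed ∷ w∈) = cong (_ ∷_) (embed-project w∈)
embed-project (free  ∷ w∈) = cong (_ ∷_) (embed-project w∈)

ham-project : ∀ {p : Face n} {u v} → u ∈ᶠ p → v ∈ᶠ p →
              ham (project p u) (project p v) ≡ ham u v
ham-project []               []           = refl
ham-project (fixed {b} ∷ u∈) (fixed ∷ v∈) =
  trans (ham-project u∈ v∈) (cong (_+ _) (sym (mismatch-refl b)))
ham-project (free      ∷ u∈) (free  ∷ v∈) = cong (_ +_) (ham-project u∈ v∈)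

-- Leaving the face by a flip of coordinate i shows that i is fixed in `p`; freeing it joins `p` to
-- its translate in direction i.
widen : ∀ i (p : Face n) w → w ∈ᶠ p → ¬ (flip i w ∈ᶠ p) →
        ∃[ q ] dim q ≡ suc (dim p) × (∀ x → x ∈ᶠ q ⇔ (x ∈ᶠ p ⊎ flip i x ∈ᶠ p))
widen zero (nothing ∷ p) (a ∷ w) (free ∷ w∈) ∉ = ⊥-elim (∉ (free ∷ w∈))
widen zero (just b ∷ p) w w∈ ∉ = nothing ∷ p , refl , λ x → mk⇔ (to x) (from x)
  where
  to : ∀ x → x ∈ᶠ nothing ∷ p → x ∈ᶠ just b ∷ p ⊎ flip zero x ∈ᶠ just b ∷ p
  to (a ∷ x) (free ∷ x∈) with a Bool.≟ b
  ... | yes refl = inj₁ (fixed ∷ x∈)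
  ... | no a≢b with refl ← Bool.¬-not (a≢b ∘ sym) = inj₂ (fixed ∷ x∈)

  from : ∀ x → x ∈ᶠ just b ∷ p ⊎ flip zero x ∈ᶠ just b ∷ p → x ∈ᶠ nothing ∷ p
  from (a ∷ x) (inj₁ (_ ∷ x∈)) = free ∷ x∈
  from (a ∷ x) (inj₂ (_ ∷ x∈)) = free ∷ x∈
widen {suc n} (suc i) (c ∷ p) (a ∷ w) (m ∷ w∈) ∉ with widen i p w w∈ (λ w′∈ → ∉ (m ∷ w′∈))
... | q , dim≡ , q⇔ = c ∷ q , dim-∷ c , λ x → mk⇔ (to x) (from x)
  where
  dim-∷ : ∀ c → dim (c ∷ q) ≡ suc (dim (c ∷ p))
  dim-∷ (just _) = dim≡
  dim-∷ nothing  = cong suc dim≡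

  to : ∀ x → x ∈ᶠ c ∷ q → x ∈ᶠ c ∷ p ⊎ flip (suc i) x ∈ᶠ c ∷ p
  to (b ∷ x) (m ∷ x∈) with Equivalence.to (q⇔ x) x∈
  ... | inj₁ x∈p = inj₁ (m ∷ x∈p)
  ... | inj₂ x∈p = inj₂ (m ∷ x∈p)

  from : ∀ x → x ∈ᶠ c ∷ p ⊎ flip (suc i) x ∈ᶠ c ∷ p → x ∈ᶠ c ∷ q
  from (b ∷ x) (inj₁ (m ∷ x∈)) = m ∷ Equivalence.from (q⇔ x) (inj₁ x∈)
  from (b ∷ x) (inj₂ (m ∷ x∈)) = m ∷ Equivalence.from (q⇔ x) (inj₂ x∈)

-- Induced cubes are faces

-- Opposite edges of a 4-cycle flip the same coordinate: j and then i are read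
-- off as coordinates in which both sides must differ from a.
square : ∀ {i j i′ j′ : Fin n} (a : Word n) → i ≢ j → i′ ≢ j →
         flip i′ (flip j a) ≡ flip j′ (flip i a) → i ≡ i′
square {i = i} {j} {i′} {j′} a i≢j i′≢j eq with j Fin.≟ j′
... | no j≢j′ = ⊥-elim (lookup-flip j a (begin
  lookup (flip j a) j            ≡⟨ lookup-flip-≢ (i′≢j ∘ sym) (flip j a) ⟨
  lookup (flip i′ (flip j a)) j  ≡⟨ cong (λ w → lookup w j) eq ⟩
  lookup (flip j′ (flip i a)) j  ≡⟨ lookup-flip-≢ j≢j′ (flip i a) ⟩
  lookup (flip i a) j            ≡⟨ lookup-flip-≢ (i≢j ∘ sym) a ⟩
  lookup a j                     ∎))
  where open ≡-Reasoning
... | yes refl = decidable-stable (i Fin.≟ i′) λ i≢i′ → lookup-flip i a (begin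
  lookup (flip i a) i            ≡⟨ lookup-flip-≢ i≢j (flip i a) ⟨
  lookup (flip j (flip i a)) i   ≡⟨ cong (λ w → lookup w i) eq ⟨
  lookup (flip i′ (flip j a)) i  ≡⟨ lookup-flip-≢ i≢i′ (flip j a) ⟩
  lookup (flip j a) i            ≡⟨ lookup-flip-≢ i≢j a ⟩
  lookup a i                     ∎)
  where open ≡-Reasoning

differInOne-∷ : ∀ a {u v : Word n} → DifferInOne u v → DifferInOne (a ∷ u) (a ∷ v)
differInOne-∷ a {u} {v} adj with differInOne⇒flip {u = u} {v} adj
... | i , refl = flip⇒differInOne (suc i) (a ∷ u)

-- Connectedness of Q_k in the form in which it is used: it turns the local equality of flip
-- directions on neighbouring words into a single global direction.
cube-connected : ∀ {k} (g : Word k → A) → (∀ w w′ → DifferInOne w w′ → g w ≡ g w′) →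
                 ∀ w w′ → g w ≡ g w′
cube-connected {k = zero}  g h []      []        = refl
cube-connected {k = suc k} g h (a ∷ w) (a′ ∷ w′) = trans
  (cube-connected (g ∘ (a ∷_)) (λ x y → h _ _ ∘ differInOne-∷ a) w w′)
  (head a a′)
  where
  head : ∀ a a′ → g (a ∷ w′) ≡ g (a′ ∷ w′)
  head false false = refl
  head true  true  = refl
  head false true  = h _ _ (flip⇒differInOne zero (false ∷ w′))
  head true  false = h _ _ (flip⇒differInOne zero (true ∷ w′))

-- Induction on k. The half with first bit 0 has a face `p` as its image. The edges joining the two
-- halves all flip one coordinate i, so the other half is mapped onto the translate of `p` in
-- direction i, and the union is `p` with i freed.
image-face : ∀ {k} (f : Word k → Word n) → Injective _≡_ _≡_ f →
             (∀ w w′ → DifferInOne w w′ → DifferInOne (f w) (f w′)) →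
             ∃[ p ] dim p ≡ k × (∀ w → f w ∈ᶠ p) × (∀ v → v ∈ᶠ p → ∃[ w ] f w ≡ v)
image-face {k = zero} f inj adj =
  Vec.map just (f []) , dim-point (f []) , (λ { [] → point-∈ (f []) }) ,
  λ v v∈ → [] , sym (point-unique v∈)
  where
  dim-point : ∀ {n} (w : Word n) → dim (Vec.map just w) ≡ 0
  dim-point []      = refl
  dim-point (_ ∷ w) = dim-point w

  point-∈ : ∀ {n} (w : Word n) → w ∈ᶠ Vec.map just w
  point-∈ []      = []
  point-∈ (_ ∷ w) = fixed ∷ point-∈ w

  point-unique : ∀ {n} {v w : Word n} → v ∈ᶠ Vec.map just w → v ≡ w
  point-unique {w = []}    []           = refl
  point-unique {w = _ ∷ _} (fixed ∷ v∈) = cong (_ ∷_) (point-unique v∈)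
image-face {n = n} {k = suc k} f inj adj
  with image-face (f ∘ (false ∷_)) (Vec.∷-injectiveʳ ∘ inj)
         (λ _ _ → adj _ _ ∘ differInOne-∷ false)
... | p , dim≡ , f₀∈p , p⊆f₀ = q , trans dim≡q (cong suc dim≡) , f∈q , q⊆f
  where
  f₀ f₁ : Word k → Word n
  f₀ w = f (false ∷ w)
  f₁ w = f (true ∷ w)

  f₀≢f₁ : ∀ w w′ → f₀ w ≢ f₁ w′
  f₀≢f₁ w w′ eq with () ← inj eq

  matching : ∀ w → ∃[ i ] f₁ w ≡ flip i (f₀ w)
  matching w = differInOne⇒flip (adj _ _ (flip⇒differInOne zero (false ∷ w)))

  dir : Word k → Fin n
  dir = proj₁ ∘ matching

  dir-const : ∀ w w′ → DifferInOne w w′ → dir w ≡ dir w′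
  dir-const w w′ ww′ = square (f₀ w) i≢j i′≢j eq
    where
    bottom-edge : ∃[ j ] f₀ w′ ≡ flip j (f₀ w)
    bottom-edge = differInOne⇒flip (adj _ _ (differInOne-∷ false ww′))

    top-edge : ∃[ j ] f₁ w′ ≡ flip j (f₁ w)
    top-edge = differInOne⇒flip (adj _ _ (differInOne-∷ true ww′))

    -- Injectivity keeps the 4-cycle from collapsing: equal directions at `w` would give
    -- `f₁ w ≡ f₀ w′`, and at `w′` they would give `f₁ w′ ≡ f₀ w`.
    i≢j : dir w ≢ proj₁ bottom-edge
    i≢j i≡j = f₀≢f₁ w′ w (trans (proj₂ bottom-edge)
      (trans (cong (λ i → flip i (f₀ w)) (sym i≡j)) (sym (proj₂ (matching w)))))

    path : f₁ w′ ≡ flip (dir w′) (flip (proj₁ bottom-edge) (f₀ w))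
    path = trans (proj₂ (matching w′)) (cong (flip (dir w′)) (proj₂ bottom-edge))

    i′≢j : dir w′ ≢ proj₁ bottom-edge
    i′≢j i′≡j = f₀≢f₁ w w′ (sym (trans path
      (trans (cong (λ i → flip i (flip (proj₁ bottom-edge) (f₀ w))) i′≡j)
        (flip-involutive (proj₁ bottom-edge) (f₀ w)))))

    eq : flip (dir w′) (flip (proj₁ bottom-edge) (f₀ w)) ≡
         flip (proj₁ top-edge) (flip (dir w) (f₀ w))
    eq = trans (sym path)
      (trans (proj₂ top-edge) (cong (flip (proj₁ top-edge)) (proj₂ (matching w))))

  z : Word k
  z = replicate k false

  i : Fin n
  i = dir z

  f₁≡ : ∀ w → f₁ w ≡ flip i (f₀ w)
  f₁≡ w = trans (proj₂ (matching w))
    (cong (λ j → flip j (f₀ w)) (cube-connected dir dir-const w z))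

  -- This word is `f₁ z`, and every word of `p` is a value of `f₀`.
  i-fixed : ¬ (flip i (f₀ z) ∈ᶠ p)
  i-fixed ∈p = let w , eq = p⊆f₀ _ ∈p in f₀≢f₁ w z (trans eq (sym (f₁≡ z)))

  wide : ∃[ q ] dim q ≡ suc (dim p) × (∀ x → x ∈ᶠ q ⇔ (x ∈ᶠ p ⊎ flip i x ∈ᶠ p))
  wide = widen i p (f₀ z) (f₀∈p z) i-fixed

  q : Face n
  q = proj₁ wide

  dim≡q : dim q ≡ suc (dim p)
  dim≡q = proj₁ (proj₂ wide)

  q⇔ : ∀ x → x ∈ᶠ q ⇔ (x ∈ᶠ p ⊎ flip i x ∈ᶠ p)
  q⇔ = proj₂ (proj₂ wide)

  flip-f₁ : ∀ w → flip i (f₁ w) ≡ f₀ w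
  flip-f₁ w = trans (cong (flip i) (f₁≡ w)) (flip-involutive i (f₀ w))

  f∈q : ∀ w → f w ∈ᶠ q
  f∈q (false ∷ w) = Equivalence.from (q⇔ _) (inj₁ (f₀∈p w))
  f∈q (true  ∷ w) = Equivalence.from (q⇔ _)
    (inj₂ (subst (_∈ᶠ p) (sym (flip-f₁ w)) (f₀∈p w)))

  q⊆f : ∀ v → v ∈ᶠ q → ∃[ w ] f w ≡ v
  q⊆f v v∈q with Equivalence.to (q⇔ v) v∈q
  ... | inj₁ v∈p = let w , eq = p⊆f₀ v v∈p in false ∷ w , eq
  ... | inj₂ v′∈p = let w , eq = p⊆f₀ _ v′∈p in
    true ∷ w , trans (f₁≡ w) (trans (cong (flip i) eq) (flip-involutive i v))

-- Finite graphs and lists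

lookup-injective : ∀ {xs : List A} → Unique xs →
                   ∀ i j → List.lookup xs i ≡ List.lookup xs j → i ≡ j
lookup-injective (x∉ ∷ uniq) zero    zero    _  = refl
lookup-injective (x∉ ∷ uniq) zero    (suc j) eq =
  contradiction eq (All.lookup x∉ (∈-lookup j))
lookup-injective (x∉ ∷ uniq) (suc i) zero    eq =
  contradiction (sym eq) (All.lookup x∉ (∈-lookup i))
lookup-injective (x∉ ∷ uniq) (suc i) (suc j) eq =
  cong suc (lookup-injective uniq i j eq)

filter-filter : ∀ {P Q : Pred A 0ℓ} (P? : Decidable P) (Q? : Decidable Q) →
                (∀ {x} → P x → Q x) → ∀ xs → filter P? (filter Q? xs) ≡ filter P? xs
filter-filter P? Q? P⇒Q [] = refl
filter-filter P? Q? P⇒Q (x ∷ xs) with P? x in eq | Q? x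
... | yes p | no ¬q = contradiction (P⇒Q p) ¬q
... | no ¬p | no _  = filter-filter P? Q? P⇒Q xs
... | yes p | yes _ rewrite eq = cong (x ∷_) (filter-filter P? Q? P⇒Q xs)
... | no ¬p | yes _ rewrite eq = filter-filter P? Q? P⇒Q xs

filter-∈-sublists : ∀ {P : Pred A 0ℓ} (P? : Decidable P) xs → filter P? xs ∈ sublists xs
filter-∈-sublists P? []       = here refl
filter-∈-sublists P? (x ∷ xs) with P? x
... | yes _ = ∈-++⁺ˡ (∈-map⁺ (x ∷_) (filter-∈-sublists P? xs))
... | no  _ = ∈-++⁺ʳ _ (filter-∈-sublists P? xs)

∈-sublists-∷ : ∀ (x : A) xs {S} → S ∈ sublists (x ∷ xs) →
               (∃[ T ] T ∈ sublists xs × S ≡ x ∷ T) ⊎ S ∈ sublists xs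
∈-sublists-∷ x xs S∈ with ∈-++⁻ (List.map (x ∷_) (sublists xs)) S∈
... | inj₁ S∈₁ = inj₁ (∈-map⁻ (x ∷_) S∈₁)
... | inj₂ S∈₂ = inj₂ S∈₂

∈-sublists⇒⊆ : ∀ (xs : List A) {S x} → S ∈ sublists xs → x ∈ S → x ∈ xs
∈-sublists⇒⊆ []       (here refl) ()
∈-sublists⇒⊆ (y ∷ xs) S∈ x∈ with ∈-sublists-∷ y xs S∈
... | inj₂ S∈′ = there (∈-sublists⇒⊆ xs S∈′ x∈)
... | inj₁ (T , T∈ , refl) with x∈
...   | here refl = here refl
...   | there x∈T = there (∈-sublists⇒⊆ xs T∈ x∈T)

sublists-unique : ∀ {xs : List A} → Unique xs → Unique (sublists xs)
sublists-unique [] = [] ∷ []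
sublists-unique {xs = x ∷ xs} (x∉ ∷ uniq) = Unique.++⁺
  (Unique.map⁺ List.∷-injectiveʳ (sublists-unique uniq)) (sublists-unique uniq)
  λ (S∈₁ , S∈₂) → disjoint (∈-map⁻ (x ∷_) S∈₁) S∈₂
  where
  disjoint : ∀ {S} → ∃[ T ] T ∈ sublists xs × S ≡ x ∷ T → S ∉ sublists xs
  disjoint (_ , _ , refl) S∈ =
    contradiction refl (All.lookup x∉ (∈-sublists⇒⊆ xs S∈ (here refl)))

-- Sublists keep the order of a duplicate-free list, so their elements determine them. This upgrades
-- equality of vertex sets to equality of lists, which counting requires.
sublist≡filter : ∀ {xs S : List A} {P : Pred A 0ℓ} (P? : Decidable P) → Unique xs →
                 S ∈ sublists xs → (∀ {x} → x ∈ xs → P x ⇔ x ∈ S) → S ≡ filter P? xs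
sublist≡filter P? [] (here refl) h = refl
sublist≡filter {xs = x ∷ xs} P? (x∉ ∷ uniq) S∈ h with ∈-sublists-∷ x xs S∈
... | inj₂ S∈′ = trans
  (sublist≡filter P? uniq S∈′ (h ∘ there))
  (sym (List.filter-reject P? λ px →
    contradiction refl (All.lookup x∉ (∈-sublists⇒⊆ xs S∈′ (Equivalence.to (h (here refl)) px)))))
... | inj₁ (T , T∈ , refl) = trans
  (cong (x ∷_) (sublist≡filter P? uniq T∈ λ y∈ → mk⇔
    (tail-∈ y∈ ∘ Equivalence.to (h (there y∈)))
    (Equivalence.from (h (there y∈)) ∘ there)))
  (sym (List.filter-accept P? (Equivalence.from (h (here refl)) (here refl))))
  where
  tail-∈ : ∀ {y} → y ∈ xs → y ∈ x ∷ T → y ∈ T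
  tail-∈ y∈ (here refl)  = contradiction refl (All.lookup x∉ y∈)
  tail-∈ y∈ (there y∈T) = y∈T

module _ (G H : FiniteGraph) where
  private
    module G = FiniteGraph G
    module H = FiniteGraph H

  -- `_≅_` speaks of positions in the vertex lists; this passes to maps between carriers. They are
  -- inverse on vertices only, since `embed` undoes `project` only on the face.
  ≅-inverse : (f : G.Carrier → H.Carrier) (g : H.Carrier → G.Carrier) →
              (∀ {x} → x ∈ vertices G → f x ∈ vertices H) →
              (∀ {y} → y ∈ vertices H → g y ∈ vertices G) →
              (∀ {x} → x ∈ vertices G → g (f x) ≡ x) →
              (∀ {y} → y ∈ vertices H → f (g y) ≡ y) →
              (∀ {x x′} → x ∈ vertices G → x′ ∈ vertices G →
                 G.Adj x x′ ⇔ H.Adj (f x) (f x′)) →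
              G ≅ H
  ≅-inverse f g f∈ g∈ gf fg adj = record
    { bijection = mk⤖
        ( (λ {i} {j} eq → lookup-injective G.unique i j (begin
            G.vertex i          ≡⟨ gf (∈-lookup i) ⟨
            g (f (G.vertex i))  ≡⟨ cong g (vertex-to i) ⟩
            g (H.vertex (to i)) ≡⟨ cong (g ∘ H.vertex) eq ⟩
            g (H.vertex (to j)) ≡⟨ cong g (vertex-to j) ⟨
            g (f (G.vertex j))  ≡⟨ gf (∈-lookup j) ⟩
            G.vertex j          ∎))
        , strictlySurjective⇒surjective (λ j → from j , lookup-injective H.unique _ _ (begin
            H.vertex (to (from j))  ≡⟨ vertex-to (from j) ⟨
            f (G.vertex (from j))   ≡⟨ cong f (lookup-index (g∈ (∈-lookup j))) ⟨
            f (g (H.vertex j))      ≡⟨ fg (∈-lookup j) ⟩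
            H.vertex j              ∎))
        )
    ; adjacency = λ i j → mk⇔
        (λ a → subst id (cong₂ H.Adj (vertex-to i) (vertex-to j))
          (Equivalence.to (adj (∈-lookup i) (∈-lookup j)) a))
        (λ a → Equivalence.from (adj (∈-lookup i) (∈-lookup j))
          (subst id (sym (cong₂ H.Adj (vertex-to i) (vertex-to j))) a))
    }
    where
    open ≡-Reasoning

    to : Fin G.order → Fin H.order
    to i = index (f∈ (∈-lookup i))

    vertex-to : ∀ i → f (G.vertex i) ≡ H.vertex (to i)
    vertex-to i = lookup-index (f∈ (∈-lookup i))

    from : Fin H.order → Fin G.order
    from j = index (g∈ (∈-lookup j))

isMinDistance-unique : ∀ G {u vs d d′} →
                       IsMinDistance G u vs d → IsMinDistance G u vs d′ → d ≡ d′
isMinDistance-unique G ((_ , v∈ , dv) , lower) ((_ , v′∈ , dv′) , lower′) =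
  ℕ.≤-antisym (lower v′∈ dv′) (lower′ v∈ dv)

-- Enumeration of the faces and their vertex sets

faces : ∀ n → List (Face n)
faces zero    = [] ∷ []
faces (suc n) = List.map (just false ∷_) (faces n) ++
                (List.map (just true ∷_) (faces n) ++ List.map (nothing ∷_) (faces n))

∈-faces : (p : Face n) → p ∈ faces n
∈-faces []               = here refl
∈-faces (just false ∷ p) = ∈-++⁺ˡ (∈-map⁺ (just false ∷_) (∈-faces p))
∈-faces {suc n} (just true  ∷ p) = ∈-++⁺ʳ (List.map (just false ∷_) (faces n))
  (∈-++⁺ˡ (∈-map⁺ (just true ∷_) (∈-faces p)))
∈-faces {suc n} (nothing    ∷ p) = ∈-++⁺ʳ (List.map (just false ∷_) (faces n))
  (∈-++⁺ʳ (List.map (just true ∷_) (faces n)) (∈-map⁺ (nothing ∷_) (∈-faces p)))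

faces-unique : ∀ n → Unique (faces n)
faces-unique zero    = [] ∷ []
faces-unique (suc n) = Unique.++⁺ cons-unique
  (Unique.++⁺ cons-unique cons-unique λ (p∈ , q∈) →
    true≢free (∈-map⁻ (just true ∷_) p∈) (∈-map⁻ (nothing ∷_) q∈))
  λ (p∈ , q∈) → false≢rest (∈-map⁻ (just false ∷_) p∈)
    (∈-++⁻ (List.map (just true ∷_) (faces n)) q∈)
  where
  cons-unique : ∀ {c} → Unique (List.map (c ∷_) (faces n))
  cons-unique = Unique.map⁺ Vec.∷-injectiveʳ (faces-unique n)

  true≢free : ∀ {w} → ∃[ x ] x ∈ faces n × w ≡ just true ∷ x →
              ¬ (∃[ y ] y ∈ faces n × w ≡ nothing ∷ y)
  true≢free (_ , _ , refl) (_ , _ , ())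

  false≢rest : ∀ {w} → ∃[ x ] x ∈ faces n × w ≡ just false ∷ x →
               ¬ (w ∈ List.map (just true ∷_) (faces n) ⊎ w ∈ List.map (nothing ∷_) (faces n))
  false≢rest (_ , _ , refl) (inj₁ w∈) with () ← proj₂ (proj₂ (∈-map⁻ (just true ∷_) w∈))
  false≢rest (_ , _ , refl) (inj₂ w∈) with () ← proj₂ (proj₂ (∈-map⁻ (nothing ∷_) w∈))

-- Filters all words, independently of any down-set. For a face inside the down-set, `filter-filter`
-- shows that filtering the vertices of the graph gives the same list.
members : Face n → List (Word n)
members p = filter (_∈ᶠ? p) (words _)

∈-members : ∀ {p : Face n} {w} → w ∈ members p ⇔ w ∈ᶠ p
∈-members {n} {p} {w} = mk⇔
  (λ w∈ → proj₂ (∈-filter⁻ (_∈ᶠ? p) {xs = words n} w∈))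
  (∈-filter⁺ (_∈ᶠ? p) (∈-words w))

members-injective : ∀ {p q : Face n} → members p ≡ members q → p ≡ q
members-injective {p = p} {q} eq = ∈ᶠ-injective p q λ w → mk⇔
  (λ w∈ → Equivalence.to ∈-members (subst (w ∈_) eq (Equivalence.from ∈-members w∈)))
  (λ w∈ → Equivalence.to ∈-members (subst (w ∈_) (sym eq) (Equivalence.from ∈-members w∈)))

-- Cubes in a subgraph of Q_n induced by a down-set

module DownSet {n : ℕ} {P : Pred (Word n) 0ℓ} (P? : Decidable P)
               (down : ∀ {v w} → v ≤ʷ w → P w → P v) where

  G : FiniteGraph
  G = induced (cube n) P?

  P⇒∈ : ∀ {w} → P w → w ∈ vertices G
  P⇒∈ {w} = ∈-filter⁺ P? (∈-words w)

  ∈⇒P : ∀ {w} → w ∈ vertices G → P w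
  ∈⇒P w∈ = proj₂ (∈-filter⁻ P? {xs = words n} w∈)

  ham≤length : ∀ {u v l} → Walk G u v l → ham u v ≤ l
  ham≤length {u} [ _ ] = ℕ.≤-reflexive (ham-refl u)
  ham≤length {u} {v} (_∷⟨_⟩_ {w = w} _ adj ws) with differInOne⇒flip {u = u} {w} adj
  ... | i , refl = ℕ.≤-trans (ham-flipˡ i u v) (s≤s (ham≤length ws))

  closer : ∀ {u v d} → P u → P v → ham u v ≡ suc d →
           ∃[ w ] DifferInOne u w × ham w v ≡ d × P w
  closer {u} {v} pu pv eq with ham-step u v eq
  ... | w , adj , eq′ , inj₁ w≤u = w , adj , eq′ , down w≤u pu
  ... | w , adj , eq′ , inj₂ w≤v = w , adj , eq′ , down w≤v pv

  shortest : ∀ d {u v} → P u → P v → ham u v ≡ d → Walk G u v d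
  shortest zero {u} {v} pu pv eq with refl ← ham≡0⇒≡ u v eq = [ P⇒∈ pu ]
  shortest (suc d) pu pv eq =
    let w , adj , eq′ , pw = closer pu pv eq in P⇒∈ pu ∷⟨ adj ⟩ shortest d pw pv eq′

  isDistance-ham : ∀ {u v} → P u → P v → IsDistance G u v (ham u v)
  isDistance-ham pu pv = shortest _ pu pv refl , λ e<d ws → ℕ.<⇒≱ e<d (ham≤length ws)

  reach : ∀ d {u v} → P u → P v → ham u v ≡ d → ∀ {j} → j ≤ d → ∃[ w ] P w × ham w v ≡ j
  reach d {u} pu pv eq j≤d with ℕ.m≤n⇒m<n∨m≡n j≤d
  ... | inj₂ refl = u , pu , eq
  reach (suc d) pu pv eq j≤d | inj₁ (s≤s j≤d′) =
    let w , _ , eq′ , pw = closer pu pv eq in reach d pw pv eq′ j≤d′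

  -- On a geodesic towards `v` every distance from 0 to `ham u v` occurs. The words found are
  -- distinguished by that distance, so they occupy `suc (ham u v)` different positions in the
  -- vertex list.
  ham<order : ∀ {u v} → P u → P v → ham u v < FiniteGraph.order G
  ham<order {u} {v} pu pv = Fin.injective⇒≤ {f = at} λ {i} {j} eq → Fin.toℕ-injective
    (trans (sym (ham-at i)) (trans (cong (λ x → ham (FiniteGraph.vertex G x) v) eq) (ham-at j)))
    where
    witness : (i : Fin (suc (ham u v))) → ∃[ w ] P w × ham w v ≡ toℕ i
    witness i = reach _ pu pv refl (ℕ.≤-pred (Fin.toℕ<n i))

    at : Fin (suc (ham u v)) → Fin (FiniteGraph.order G)
    at i = index (P⇒∈ (proj₁ (proj₂ (witness i))))

    ham-at : ∀ i → ham (FiniteGraph.vertex G (at i)) v ≡ toℕ i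
    ham-at i = trans
      (cong (λ w → ham w v) (sym (lookup-index (P⇒∈ (proj₁ (proj₂ (witness i)))))))
      (proj₂ (proj₂ (witness i)))

  ∈-face⇒P : ∀ {p w} → P (top p) → w ∈ᶠ p → P w
  ∈-face⇒P pt w∈ = down (∈⇒≤top w∈) pt

  ∈-inducedOn : ∀ {S w} → w ∈ vertices (inducedOn G S) ⇔ (P w × w ∈ S)
  ∈-inducedOn {S} {w} = mk⇔
    (λ w∈ → let w∈V , w∈S = ∈-filter⁻ (_∈? S) {xs = vertices G} w∈ in ∈⇒P w∈V , w∈S)
    (λ (pw , w∈S) → ∈-filter⁺ (_∈? S) (P⇒∈ pw) w∈S)
    where open DecMembership (FiniteGraph._≟_ G) using (_∈?_)

  ∈-inducedOn-members : ∀ {p} → P (top p) → ∀ {w} →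
                        w ∈ vertices (inducedOn G (members p)) ⇔ w ∈ᶠ p
  ∈-inducedOn-members {p} pt = mk⇔
    (Equivalence.to ∈-members ∘ proj₂ ∘ Equivalence.to (∈-inducedOn {members p}))
    (λ w∈ → Equivalence.from ∈-inducedOn (∈-face⇒P pt w∈ , Equivalence.from ∈-members w∈))

  face≅cube : ∀ p → P (top p) → inducedOn G (members p) ≅ cube (dim p)
  face≅cube p pt = ≅-inverse (inducedOn G (members p)) (cube (dim p)) (project p) (embed p)
    (λ {w} _ → ∈-words (project p w))
    (λ {w} _ → Equivalence.from (∈-inducedOn-members pt) (embed-∈ p w))
    (embed-project ∘ Equivalence.to (∈-inducedOn-members pt))
    (λ {w} _ → project-embed p w)
    λ {x} {y} x∈ y∈ →
      let eq = ham-project (Equivalence.to (∈-inducedOn-members pt) x∈)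
                           (Equivalence.to (∈-inducedOn-members pt) y∈)
      in mk⇔ (λ a → ham≡1⇒differInOne (project p x) (project p y)
                      (trans eq (differInOne⇒ham≡1 x y a)))
             (λ a → ham≡1⇒differInOne x y
                      (trans (sym eq) (differInOne⇒ham≡1 (project p x) (project p y) a)))

  -- The gate attains the value, and no walk to the face is shorter than the Hamming distance. The
  -- list `vs` is kept arbitrary to serve also for an induced cube not yet identified with
  -- `members p`.
  isMinDistance-face : ∀ {u p vs} → P u → P (top p) → (∀ {w} → w ∈ vs ⇔ w ∈ᶠ p) →
                       IsMinDistance G u vs (dist u p)
  isMinDistance-face {u} {p} pu pt vs⇔ =
    ( nearest u p
    , Equivalence.from vs⇔ (nearest-∈ u p)
    , subst (IsDistance G u (nearest u p)) (ham-nearest u p)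
        (isDistance-ham pu (∈-face⇒P pt (nearest-∈ u p)))
    ) ,
    λ v∈ (ws , _) → ℕ.≤-trans (dist≤ham u (Equivalence.to vs⇔ v∈)) (ham≤length ws)

  face-isCube : ∀ {u k d} p → P u → P (top p) → dim p ≡ k → dist u p ≡ d →
                IsCubeAtDistance G u k d (members p)
  face-isCube p pu pt refl refl =
    face≅cube p pt , isMinDistance-face pu pt (∈-inducedOn-members pt)

  members-∈-sublists : ∀ p → P (top p) → members p ∈ sublists (vertices G)
  members-∈-sublists p pt = subst (_∈ sublists (vertices G))
    (filter-filter (_∈ᶠ? p) P? (∈-face⇒P pt) (words n))
    (filter-∈-sublists (_∈ᶠ? p) (vertices G))

  -- The isomorphism is read backwards, from positions to words: its inverse is an injective,
  -- edge-preserving map of Q_k onto the vertices of the subgraph, to which `image-face` applies.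
  cube-face : ∀ {S k} → inducedOn G S ≅ cube k →
              ∃[ p ] dim p ≡ k × (∀ {w} → w ∈ vertices (inducedOn G S) ⇔ w ∈ᶠ p)
  cube-face {S} {k} iso =
    let p , dim≡ , f∈p , p⊆f = image-face f f-injective f-adj in
    p , dim≡ , mk⇔
      (λ w∈ → let x , eq = f-surjective w∈ in subst (_∈ᶠ p) eq (f∈p x))
      (λ w∈ → let x , eq = p⊆f _ w∈ in subst (_∈ vertices H) eq (∈-lookup (from x)))
    where
    open _≅_ iso
    open Bijection bijection using (injective; surjective)

    H : FiniteGraph
    H = inducedOn G S

    module Q = FiniteGraph (cube k)

    from : Word k → Fin (FiniteGraph.order H)
    from x = proj₁ (surjective (index (∈-words x)))

    f : Word k → Word n
    f x = FiniteGraph.vertex H (from x)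

    vertex-to : ∀ x → Q.vertex (to (from x)) ≡ x
    vertex-to x = trans
      (cong Q.vertex (proj₂ (surjective (index (∈-words x))) refl))
      (sym (lookup-index (∈-words x)))

    f-injective : Injective _≡_ _≡_ f
    f-injective {x} {y} eq = trans (sym (vertex-to x)) (trans
      (cong (Q.vertex ∘ to) (lookup-injective (FiniteGraph.unique H) (from x) (from y) eq))
      (vertex-to y))

    f-adj : ∀ x y → DifferInOne x y → DifferInOne (f x) (f y)
    f-adj x y a = Equivalence.from (adjacency (from x) (from y))
      (subst id (sym (cong₂ DifferInOne (vertex-to x) (vertex-to y))) a)

    f-surjective : ∀ {w} → w ∈ vertices H → ∃[ x ] f x ≡ w
    f-surjective {w} w∈ = x , trans (cong (FiniteGraph.vertex H) from-x) (sym (lookup-index w∈))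
      where
      x : Word k
      x = Q.vertex (to (index w∈))

      from-x : from x ≡ index w∈
      from-x = injective (lookup-injective Q.unique _ _ (vertex-to x))

  isCube⇒face : ∀ {u k d S} → P u → S ∈ sublists (vertices G) → IsCubeAtDistance G u k d S →
                ∃[ p ] P (top p) × dim p ≡ k × dist u p ≡ d × S ≡ members p
  isCube⇒face {S = S} pu S∈ (iso , min) with cube-face {S} iso
  ... | p , dim≡ , H⇔ =
    p , pt , dim≡ , isMinDistance-unique G (isMinDistance-face pu pt H⇔) min ,
    trans (sublist≡filter (_∈ᶠ? p) (FiniteGraph.unique G) S∈ λ w∈ → mk⇔
            (proj₂ ∘ Equivalence.to ∈-inducedOn ∘ Equivalence.from H⇔)
            (λ w∈S → Equivalence.to H⇔ (Equivalence.from ∈-inducedOn (∈⇒P w∈ , w∈S))))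
          (filter-filter (_∈ᶠ? p) P? (∈-face⇒P pt) (words n))
    where
    -- The top vertex lies in the face, hence in the induced subgraph, all of whose vertices satisfy
    -- `P`.
    pt : P (top p)
    pt = proj₁ (Equivalence.to (∈-inducedOn {S}) (Equivalence.from H⇔ (nearest-∈ _ p)))

  facesIn : List (Face n)
  facesIn = filter (P? ∘ top) (faces n)

  -- `members` is injective, so both sides are lengths of duplicate-free lists of vertex sets; these
  -- have the same elements and are therefore permutations of each other.
  cubeCount≡ : ∀ {u} → P u → ∀ k d → cubeCount G u k d ≡
               length (filter (λ p → (dim p ℕ.≟ k) ×-dec (dist u p ℕ.≟ d)) facesIn)
  cubeCount≡ {u} pu k d = trans
    (↭-length (∼bag⇒↭ (unique∧set⇒bag
      (Unique.filter⁺ isCube? (sublists-unique (FiniteGraph.unique G)))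
      (Unique.map⁺ members-injective
        (Unique.filter⁺ ofType? (Unique.filter⁺ (P? ∘ top) (faces-unique n))))
      (mk⇔ cube⇒ ⇒cube))))
    (List.length-map members (filter ofType? facesIn))
    where
    isCube? : Decidable (IsCubeAtDistance G u k d)
    isCube? = isCubeAtDistance? G u k d

    ofType? : Decidable (λ p → dim p ≡ k × dist u p ≡ d)
    ofType? p = (dim p ℕ.≟ k) ×-dec (dist u p ℕ.≟ d)

    cube⇒ : ∀ {S} → S ∈ filter isCube? (sublists (vertices G)) →
            S ∈ List.map members (filter ofType? facesIn)
    cube⇒ S∈ with ∈-filter⁻ isCube? {xs = sublists (vertices G)} S∈
    ... | S∈′ , isCube with isCube⇒face pu S∈′ isCube
    ...   | p , pt , dim≡ , dist≡ , refl =
      ∈-map⁺ members (∈-filter⁺ ofType? (∈-filter⁺ (P? ∘ top) (∈-faces p) pt) (dim≡ , dist≡))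

    ⇒cube : ∀ {S} → S ∈ List.map members (filter ofType? facesIn) →
            S ∈ filter isCube? (sublists (vertices G))
    ⇒cube {S} S∈ =
      let p , p∈ , S≡     = ∈-map⁻ members S∈
          p∈′ , dim≡ , dist≡ = ∈-filter⁻ ofType? {xs = facesIn} p∈
          pt = proj₂ (∈-filter⁻ (P? ∘ top) {xs = faces n} p∈′)
      in subst (_∈ filter isCube? (sublists (vertices G))) (sym S≡)
           (∈-filter⁺ isCube? (members-∈-sublists p pt) (face-isCube p pu pt dim≡ dist≡))

-- Coefficients of P(x, -x)

coeff-+ : ∀ p q m → coeff (p +ₚ q) m ≡ coeff p m ℤ.+ coeff q m
coeff-+ []      q       m       = sym (ℤ.+-identityˡ _)
coeff-+ (a ∷ p) []      m       = sym (ℤ.+-identityʳ _)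
coeff-+ (a ∷ p) (b ∷ q) zero    = refl
coeff-+ (a ∷ p) (b ∷ q) (suc m) = coeff-+ p q m

coeff-scale : ∀ a p m → coeff (List.map (a ℤ.*_) p) m ≡ a ℤ.* coeff p m
coeff-scale a []      m       = sym (ℤ.*-zeroʳ a)
coeff-scale a (b ∷ p) zero    = refl
coeff-scale a (b ∷ p) (suc m) = coeff-scale a p m

coeff--x*-zero : ∀ p → coeff ((-ₚ xₚ) *ₚ p) 0 ≡ 0ℤ
coeff--x*-zero p = trans (coeff-+ (List.map (0ℤ ℤ.*_) p) _ 0)
  (trans (ℤ.+-identityʳ _) (coeff-scale 0ℤ p 0))

coeff--x*-suc : ∀ p m → coeff ((-ₚ xₚ) *ₚ p) (suc m) ≡ ℤ.- coeff p m
coeff--x*-suc p m = begin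
  coeff ((-ₚ xₚ) *ₚ p) (suc m)
    ≡⟨ coeff-+ (List.map (0ℤ ℤ.*_) p) _ (suc m) ⟩
  coeff (List.map (0ℤ ℤ.*_) p) (suc m) ℤ.+ coeff (List.map (-1ℤ ℤ.*_) p +ₚ (0ℤ ∷ [])) m
    ≡⟨ cong₂ ℤ._+_ (coeff-scale 0ℤ p (suc m)) (coeff-+ (List.map (-1ℤ ℤ.*_) p) (0ℤ ∷ []) m) ⟩
  0ℤ ℤ.+ (coeff (List.map (-1ℤ ℤ.*_) p) m ℤ.+ coeff (0ℤ ∷ []) m)
    ≡⟨ ℤ.+-identityˡ _ ⟩
  coeff (List.map (-1ℤ ℤ.*_) p) m ℤ.+ coeff (0ℤ ∷ []) m
    ≡⟨ cong₂ ℤ._+_ (coeff-scale -1ℤ p m) (coeff-0 m) ⟩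
  -1ℤ ℤ.* coeff p m ℤ.+ 0ℤ
    ≡⟨ ℤ.+-identityʳ _ ⟩
  -1ℤ ℤ.* coeff p m
    ≡⟨ ℤ.-1*i≡-i _ ⟩
  ℤ.- coeff p m ∎
  where
  open ≡-Reasoning

  coeff-0 : ∀ m → coeff (0ℤ ∷ []) m ≡ 0ℤ
  coeff-0 zero    = refl
  coeff-0 (suc m) = refl

coeff-applyUpTo : ∀ (f : ℕ → ℤ) N → (∀ k → N ≤ k → f k ≡ 0ℤ) →
                  ∀ m → coeff (applyUpTo f N) m ≡ f m
coeff-applyUpTo f zero    h m       = sym (h m z≤n)
coeff-applyUpTo f (suc N) h zero    = refl
coeff-applyUpTo f (suc N) h (suc m) = coeff-applyUpTo (f ∘ suc) N (λ k N≤k → h (suc k) (s≤s N≤k)) m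

-- The coefficient of x^m in Σ_{d<N} Σ_k c d k x^k (-x)^d.
antidiagonal : (ℕ → ℕ → ℤ) → ℕ → ℕ → ℤ
antidiagonal c zero    m       = 0ℤ
antidiagonal c (suc N) zero    = c 0 0
antidiagonal c (suc N) (suc m) = c 0 (suc m) ℤ.- antidiagonal (c ∘ suc) N m

-- `_[y≔_]` is Horner's rule, and multiplying by -x shifts the coefficients by one place and changes
-- their sign; `antidiagonal` follows the same recursion.
coeff-[y≔-x] : ∀ (r : ℕ → Poly) (c : ℕ → ℕ → ℤ) → (∀ d k → coeff (r d) k ≡ c d k) →
               ∀ N m → coeff (applyUpTo r N [y≔ -ₚ xₚ ]) m ≡ antidiagonal c N m
coeff-[y≔-x] r c h zero    m       = refl
coeff-[y≔-x] r c h (suc N) zero    = trans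
  (coeff-+ (r 0) _ 0)
  (trans (cong₂ ℤ._+_ (h 0 0) (coeff--x*-zero (applyUpTo (r ∘ suc) N [y≔ -ₚ xₚ ])))
         (ℤ.+-identityʳ _))
coeff-[y≔-x] r c h (suc N) (suc m) = trans
  (coeff-+ (r 0) _ (suc m))
  (cong₂ ℤ._+_ (h 0 (suc m))
    (trans (coeff--x*-suc (applyUpTo (r ∘ suc) N [y≔ -ₚ xₚ ]) m)
           (cong ℤ.-_ (coeff-[y≔-x] (r ∘ suc) (c ∘ suc) (h ∘ suc) N m))))

antidiagonal-0 : ∀ c → (∀ d k → c d k ≡ 0ℤ) → ∀ N m → antidiagonal c N m ≡ 0ℤ
antidiagonal-0 c h zero    m       = refl
antidiagonal-0 c h (suc N) zero    = h 0 0
antidiagonal-0 c h (suc N) (suc m) =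
  cong₂ ℤ._-_ (h 0 (suc m)) (antidiagonal-0 (c ∘ suc) (h ∘ suc) N m)

antidiagonal-+ : ∀ c c₁ c₂ → (∀ d k → c d k ≡ c₁ d k ℤ.+ c₂ d k) →
                 ∀ N m → antidiagonal c N m ≡ antidiagonal c₁ N m ℤ.+ antidiagonal c₂ N m
antidiagonal-+ c c₁ c₂ h zero    m       = refl
antidiagonal-+ c c₁ c₂ h (suc N) zero    = h 0 0
antidiagonal-+ c c₁ c₂ h (suc N) (suc m) = trans
  (cong₂ ℤ._-_ (h 0 (suc m)) (antidiagonal-+ (c ∘ suc) (c₁ ∘ suc) (c₂ ∘ suc) (h ∘ suc) N m))
  (rearrange (c₁ 0 (suc m)) (c₂ 0 (suc m)) _ _)
  where
  rearrange : ∀ a b x y → (a ℤ.+ b) ℤ.- (x ℤ.+ y) ≡ (a ℤ.- x) ℤ.+ (b ℤ.- y)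
  rearrange = solve-∀

kronecker : ℕ → ℕ → ℤ
kronecker zero    zero    = 1ℤ
kronecker zero    (suc m) = 0ℤ
kronecker (suc k) zero    = 0ℤ
kronecker (suc k) (suc m) = kronecker k m

kronecker-refl : ∀ k → kronecker k k ≡ 1ℤ
kronecker-refl zero    = refl
kronecker-refl (suc k) = kronecker-refl k

kronecker-≢ : ∀ {k m} → k ≢ m → kronecker k m ≡ 0ℤ
kronecker-≢ {zero}  {zero}  k≢m = contradiction refl k≢m
kronecker-≢ {zero}  {suc m} k≢m = refl
kronecker-≢ {suc k} {zero}  k≢m = refl
kronecker-≢ {suc k} {suc m} k≢m = kronecker-≢ (k≢m ∘ cong suc)

-- The coefficient of x^m in x^k (-x)^d.
monomial : ℕ → ℕ → ℕ → ℤ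
monomial k zero    m       = kronecker k m
monomial k (suc d) zero    = 0ℤ
monomial k (suc d) (suc m) = ℤ.- monomial k d m

monomial-x-zero : ∀ k d → monomial (suc k) d zero ≡ 0ℤ
monomial-x-zero k zero    = refl
monomial-x-zero k (suc d) = refl

monomial-x-suc : ∀ k d m → monomial (suc k) d (suc m) ≡ monomial k d m
monomial-x-suc k zero    m       = refl
monomial-x-suc k (suc d) zero    = cong ℤ.-_ (monomial-x-zero k d)
monomial-x-suc k (suc d) (suc m) = cong ℤ.-_ (monomial-x-suc k d m)

-- The bound `d₀ < N` keeps the only nonzero row among the N rows summed; each zero row before it
-- contributes one shift and one sign.
antidiagonal-monomial : ∀ c {k₀ d₀} → c d₀ k₀ ≡ 1ℤ →
                        (∀ d k → ¬ (k₀ ≡ k × d₀ ≡ d) → c d k ≡ 0ℤ) →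
                        ∀ {N} → d₀ < N → ∀ m → antidiagonal c N m ≡ monomial k₀ d₀ m
antidiagonal-monomial c {k₀} {zero} c≡1 c≡0 {suc N} _ m = trans (first-row m) (c₀ m)
  where
  c₀ : ∀ m → c 0 m ≡ kronecker k₀ m
  c₀ m with k₀ ℕ.≟ m
  ... | yes refl = trans c≡1 (sym (kronecker-refl k₀))
  ... | no k₀≢m  = trans (c≡0 0 m (k₀≢m ∘ proj₁)) (sym (kronecker-≢ k₀≢m))

  first-row : ∀ m → antidiagonal c (suc N) m ≡ c 0 m
  first-row zero    = refl
  first-row (suc m) = trans
    (cong (λ z → c 0 (suc m) ℤ.- z)
      (antidiagonal-0 (c ∘ suc) (λ d k → c≡0 (suc d) k λ { (_ , ()) }) N m))
    (ℤ.+-identityʳ _)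
antidiagonal-monomial c {k₀} {suc d₀} c≡1 c≡0 {suc N} (s≤s d₀<N) zero =
  c≡0 0 0 λ { (_ , ()) }
antidiagonal-monomial c {k₀} {suc d₀} c≡1 c≡0 {suc N} (s≤s d₀<N) (suc m) = trans
  (cong₂ ℤ._-_ (c≡0 0 (suc m) λ { (_ , ()) })
    (antidiagonal-monomial (c ∘ suc) c≡1
      (λ d k ne → c≡0 (suc d) k λ (k≡ , d≡) → ne (k≡ , ℕ.suc-injective d≡)) d₀<N m))
  (ℤ.+-identityˡ _)

-- Finite sums, and counts by dimension and distance

∑ : List A → (A → ℤ) → ℤ
∑ []       f = 0ℤ
∑ (x ∷ xs) f = f x ℤ.+ ∑ xs f

∑-++ : ∀ (xs ys : List A) f → ∑ (xs ++ ys) f ≡ ∑ xs f ℤ.+ ∑ ys f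
∑-++ []       ys f = sym (ℤ.+-identityˡ _)
∑-++ (x ∷ xs) ys f = trans (cong (λ z → f x ℤ.+ z) (∑-++ xs ys f)) (sym (ℤ.+-assoc (f x) _ _))

∑-map : ∀ (g : A → B) xs f → ∑ (List.map g xs) f ≡ ∑ xs (f ∘ g)
∑-map g []       f = refl
∑-map g (x ∷ xs) f = cong (λ z → f (g x) ℤ.+ z) (∑-map g xs f)

∑-cong : ∀ (xs : List A) {f g} → (∀ x → f x ≡ g x) → ∑ xs f ≡ ∑ xs g
∑-cong []       h = refl
∑-cong (x ∷ xs) h = cong₂ ℤ._+_ (h x) (∑-cong xs h)

∑-0 : ∀ (xs : List A) {f} → (∀ x → f x ≡ 0ℤ) → ∑ xs f ≡ 0ℤ
∑-0 []       h = refl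
∑-0 (x ∷ xs) h = cong₂ ℤ._+_ (h x) (∑-0 xs h)

∑-neg : ∀ (xs : List A) f → ∑ xs (λ x → ℤ.- f x) ≡ ℤ.- ∑ xs f
∑-neg []       f = refl
∑-neg (x ∷ xs) f = trans (cong (λ z → (ℤ.- f x) ℤ.+ z) (∑-neg xs f)) (sym (ℤ.neg-distrib-+ (f x) _))

∑-filter : ∀ {P : Pred A 0ℓ} (P? : Decidable P) xs f →
           ∑ (filter P? xs) f ≡ ∑ xs (λ x → if does (P? x) then f x else 0ℤ)
∑-filter P? []       f = refl
∑-filter P? (x ∷ xs) f with does (P? x)
... | true  = cong (λ z → f x ℤ.+ z) (∑-filter P? xs f)
... | false = trans (∑-filter P? xs f) (sym (ℤ.+-identityˡ _))

module _ (k d : A → ℕ) where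

  ofType? : ∀ k₀ d₀ → Decidable (λ p → k p ≡ k₀ × d p ≡ d₀)
  ofType? k₀ d₀ p = (k p ℕ.≟ k₀) ×-dec (d p ℕ.≟ d₀)

  count : List A → ℕ → ℕ → ℤ
  count ps d₀ k₀ = pos (length (filter (ofType? k₀ d₀) ps))

  count-∷ : ∀ p ps d₀ k₀ → count (p ∷ ps) d₀ k₀ ≡ count (p ∷ []) d₀ k₀ ℤ.+ count ps d₀ k₀
  count-∷ p ps d₀ k₀ with does (ofType? k₀ d₀ p)
  ... | true  = refl
  ... | false = refl

  -- Exchange of summation: the table of counts is a sum of tables with a single 1, one for each
  -- list entry, and `antidiagonal` is additive.
  antidiagonal-count : ∀ {N} ps → All (λ p → d p < N) ps → ∀ m →
                       antidiagonal (count ps) N m ≡ ∑ ps (λ p → monomial (k p) (d p) m)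
  antidiagonal-count {N} []       []            m = antidiagonal-0 _ (λ _ _ → refl) N m
  antidiagonal-count {N} (p ∷ ps) (d<N ∷ d<Ns) m = trans
    (antidiagonal-+ _ _ _ (count-∷ p ps) N m)
    (cong₂ ℤ._+_
      (antidiagonal-monomial (count (p ∷ []))
        (cong (pos ∘ length) (List.filter-accept (ofType? (k p) (d p)) {xs = []} (refl , refl)))
        (λ d₀ k₀ ne → cong (pos ∘ length) (List.filter-reject (ofType? k₀ d₀) {xs = []} ne))
        d<N m)
      (antidiagonal-count ps d<Ns m))

  count-≥ : ∀ {N} ps → All (λ p → k p < N) ps → ∀ d₀ k₀ → N ≤ k₀ → count ps d₀ k₀ ≡ 0ℤ
  count-≥ ps k<N d₀ k₀ N≤k₀ = cong (pos ∘ length)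
    (List.filter-none (ofType? k₀ d₀)
      (All.map (λ k<N (k≡ , _) → ℕ.<⇒≱ k<N (subst (_ ≤_) (sym k≡) N≤k₀)) k<N))

-- The signed face sum of a down-set

-- Membership of the top in the down-set enters as a factor 0 or 1, not as a filter on the list, so
-- the sum still runs over `faces n` and splits by the first entry.
guarded : Bool → ℕ → ℕ → ℕ → ℤ
guarded b k d m = if b then monomial k d m else 0ℤ

guarded-x-zero : ∀ b k d → guarded b (suc k) d zero ≡ 0ℤ
guarded-x-zero false k d = refl
guarded-x-zero true  k d = monomial-x-zero k d

guarded-x-suc : ∀ b k d m → guarded b (suc k) d (suc m) ≡ guarded b k d m
guarded-x-suc false k d m = refl
guarded-x-suc true  k d m = monomial-x-suc k d m

guarded--x-zero : ∀ b k d → guarded b k (suc d) zero ≡ 0ℤ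
guarded--x-zero false k d = refl
guarded--x-zero true  k d = refl

guarded--x-suc : ∀ b k d m → guarded b k (suc d) (suc m) ≡ ℤ.- guarded b k d m
guarded--x-suc false k d m = refl
guarded--x-suc true  k d m = refl

faceSum : {P : Pred (Word n) 0ℓ} → Decidable P → Word n → ℕ → ℤ
faceSum {n} P? u m = ∑ (faces n) (λ p → guarded (does (P? (top p))) (dim p) (dist u p) m)

module _ {P : Pred (Word (suc n)) 0ℓ} (P? : Decidable P) (a : Bool) (u : Word n) where
  private
    term : ℕ → Face (suc n) → ℤ
    term m p = guarded (does (P? (top p))) (dim p) (dist (a ∷ u) p) m

    part : ℕ → Maybe Bool → ℤ
    part m c = ∑ (faces n) (term m ∘ (c ∷_))

  faceSum-suc : ∀ m → faceSum P? (a ∷ u) m ≡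
                part m (just false) ℤ.+ (part m (just true) ℤ.+ part m nothing)
  faceSum-suc m = trans (∑-++ (List.map (just false ∷_) (faces n)) _ (term m))
    (cong₂ ℤ._+_ (∑-map (just false ∷_) (faces n) (term m))
      (trans (∑-++ (List.map (just true ∷_) (faces n)) _ (term m))
        (cong₂ ℤ._+_ (∑-map (just true ∷_) (faces n) (term m))
                     (∑-map (nothing ∷_) (faces n) (term m)))))

  free-zero : part 0 nothing ≡ 0ℤ
  free-zero = ∑-0 (faces n) λ p →
    guarded-x-zero (does (P? (true ∷ top p))) (dim p) (dist u p)

  -- The top of a face with free first coordinate begins with 1, so its guard is that of the slice
  -- at 1; the free coordinate supplies the factor x.
  free-suc : ∀ m → part (suc m) nothing ≡ faceSum (P? ∘ (true ∷_)) u m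
  free-suc m = ∑-cong (faces n) λ p →
    guarded-x-suc (does (P? (true ∷ top p))) (dim p) (dist u p) m

module _ {P : Pred (Word n) 0ℓ} (P? : Decidable P) (u : Word n) where

  mismatch-zero : ∑ (faces n) (λ p → guarded (does (P? (top p))) (dim p) (suc (dist u p)) 0) ≡ 0ℤ
  mismatch-zero = ∑-0 (faces n) λ p → guarded--x-zero (does (P? (top p))) (dim p) (dist u p)

  mismatch-suc : ∀ m →
    ∑ (faces n) (λ p → guarded (does (P? (top p))) (dim p) (suc (dist u p)) (suc m)) ≡
    ℤ.- faceSum P? u m
  mismatch-suc m = trans
    (∑-cong (faces n) λ p → guarded--x-suc (does (P? (top p))) (dim p) (dist u p) m)
    (∑-neg (faces n) _)

-- By the first coordinate, with F₀ and F₁ the sums over the two slices: for u₀ = 0 the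
-- total is F₀ - x F₁ + x F₁, and for u₀ = 1 it is - x F₀ + F₁ + x F₁ with F₀ = F₁ = 1.
faceSum≡1 : {P : Pred (Word n) 0ℓ} (P? : Decidable P) →
            (∀ {v w} → v ≤ʷ w → P w → P v) → ∀ u → P u → ∀ m → faceSum P? u m ≡ coeff 1ₚ m
faceSum≡1 P? down [] pu m with P? []
... | no ¬p = contradiction pu ¬p
faceSum≡1 P? down [] pu zero    | yes _ = refl
faceSum≡1 P? down [] pu (suc m) | yes _ = refl
faceSum≡1 P? down (false ∷ u) pu zero = trans (faceSum-suc P? false u 0)
  (trans (cong₂ ℤ._+_ (faceSum≡1 (P? ∘ (false ∷_)) (down ∘ (b≤b ∷_)) u pu 0)
           (cong₂ ℤ._+_ (mismatch-zero (P? ∘ (true ∷_)) u) (free-zero P? false u)))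
         (ℤ.+-identityʳ _))
faceSum≡1 P? down (false ∷ u) pu (suc m) = trans (faceSum-suc P? false u (suc m))
  (trans (cong₂ ℤ._+_ (faceSum≡1 (P? ∘ (false ∷_)) (down ∘ (b≤b ∷_)) u pu (suc m))
           -- The induction hypothesis may fail to cover the slice at 1, which need not contain `u`.
           -- Its sum stays unevaluated and cancels.
           (trans (cong₂ ℤ._+_ (mismatch-suc (P? ∘ (true ∷_)) u m) (free-suc P? false u m))
                  (ℤ.+-inverseˡ (faceSum (P? ∘ (true ∷_)) u m))))
         (ℤ.+-identityʳ _))
faceSum≡1 P? down (true ∷ u) pu zero = trans (faceSum-suc P? true u 0)
  (cong₂ ℤ._+_ (mismatch-zero (P? ∘ (false ∷_)) u)
    (cong₂ ℤ._+_ (faceSum≡1 (P? ∘ (true ∷_)) (down ∘ (b≤b ∷_)) u pu 0) (free-zero P? true u)))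
faceSum≡1 P? down (true ∷ u) pu (suc m) = trans (faceSum-suc P? true u (suc m))
  (trans (cong₂ ℤ._+_
           (trans (mismatch-suc (P? ∘ (false ∷_)) u m)
             (cong ℤ.-_ (faceSum≡1 (P? ∘ (false ∷_)) (down ∘ (b≤b ∷_)) u
               -- Closure downwards puts `u` into the slice at 0, so the induction hypothesis covers
               -- both slices.
               (down (f≤t ∷ ≤ʷ-refl) pu) m)))
           (cong₂ ℤ._+_
             (faceSum≡1 (P? ∘ (true ∷_)) (down ∘ (b≤b ∷_)) u pu (suc m))
             (trans (free-suc P? true u m)
               (faceSum≡1 (P? ∘ (true ∷_)) (down ∘ (b≤b ∷_)) u pu m))))
         (trans (cong (λ z → (ℤ.- coeff 1ₚ m) ℤ.+ z) (ℤ.+-identityˡ _))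
                (ℤ.+-inverseˡ (coeff 1ₚ m))))

-- The evaluation for down-sets and for daisy cubes

-- A record, so that comparing the claims for two presentations of a graph compares the
-- graphs instead of unfolding their polynomials.
record EvaluatesToOne (G : FiniteGraph) (u : FiniteGraph.Carrier G) : Set where
  field
    D[x,-x]≈1 : distanceCubePolynomial G u [y≔ -ₚ xₚ ] ≈ₚ 1ₚ

module _ {P : Pred (Word n) 0ℓ} (P? : Decidable P)
         (down : ∀ {v w} → v ≤ʷ w → P w → P v) {u : Word n} (pu : P u) where
  open DownSet P? down

  private
    N : ℕ
    N = FiniteGraph.order G

    row : ℕ → Poly
    row d = List.map (λ k → pos (cubeCount G u k d)) (upTo N)

    top-P : ∀ {p} → p ∈ facesIn → P (top p)
    top-P p∈ = proj₂ (∈-filter⁻ (P? ∘ top) {xs = faces n} p∈)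

    dist<N : ∀ {p} → p ∈ facesIn → dist u p < N
    dist<N {p} p∈ = subst (_< N) (ham-nearest u p)
      (ham<order pu (∈-face⇒P (top-P p∈) (nearest-∈ u p)))

    dim<N : ∀ {p} → p ∈ facesIn → dim p < N
    dim<N {p} p∈ = subst (_< N) (ham-bottom-top p)
      (ham<order (∈-face⇒P (top-P p∈) (nearest-∈ (replicate n false) p)) (top-P p∈))

    coeff-row : ∀ d k → coeff (row d) k ≡ count dim (dist u) facesIn d k
    coeff-row d k = begin
      coeff (row d) k
        ≡⟨ cong (λ r → coeff r k) (List.map-upTo (λ k → pos (cubeCount G u k d)) N) ⟩
      coeff (applyUpTo (λ k → pos (cubeCount G u k d)) N) k
        ≡⟨ coeff-applyUpTo _ N (λ k N≤k → trans (cong pos (cubeCount≡ pu k d))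
             (count-≥ dim (dist u) facesIn (All.tabulate dim<N) d k N≤k)) k ⟩
      pos (cubeCount G u k d)
        ≡⟨ cong pos (cubeCount≡ pu k d) ⟩
      count dim (dist u) facesIn d k ∎
      where open ≡-Reasoning

  evaluatesToOne : EvaluatesToOne G u
  evaluatesToOne .EvaluatesToOne.D[x,-x]≈1 m = begin
    coeff (distanceCubePolynomial G u [y≔ -ₚ xₚ ]) m
      ≡⟨ cong (λ D → coeff (D [y≔ -ₚ xₚ ]) m) (List.map-upTo row N) ⟩
    coeff (applyUpTo row N [y≔ -ₚ xₚ ]) m
      ≡⟨ coeff-[y≔-x] row (count dim (dist u) facesIn) coeff-row N m ⟩
    antidiagonal (count dim (dist u) facesIn) N m
      ≡⟨ antidiagonal-count dim (dist u) facesIn (All.tabulate dist<N) m ⟩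
    ∑ facesIn (λ p → monomial (dim p) (dist u p) m)
      ≡⟨ ∑-filter (P? ∘ top) (faces n) _ ⟩
    faceSum P? u m
      ≡⟨ faceSum≡1 P? down u pu m ⟩
    coeff 1ₚ m ∎
    where open ≡-Reasoning

∈-daisyCube⇒below : ∀ {X : Pred (Word n) 0ℓ} (X? : Decidable X) {u} →
                    u ∈ vertices (daisyCube X?) → Below X u
∈-daisyCube⇒below {n} X? u∈ = proj₂ (∈-filter⁻ (below? X?) {xs = words n} u∈)

daisyCube-evaluatesToOne : ∀ {X : Pred (Word n) 0ℓ} (X? : Decidable X) {u} →
                           Below X u → EvaluatesToOne (daisyCube X?) u
daisyCube-evaluatesToOne X? = evaluatesToOne (below? X?)
  λ v≤w (x , Xx , w≤x) → x , Xx , Pointwise.trans Bool.≤-trans v≤w w≤x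

theorem4p1 : (n : ℕ) (X : Pred (Word n) 0ℓ) (X? : Decidable X) →
    (u : Word n) → u ∈ vertices (daisyCube X?) →
    distanceCubePolynomial (daisyCube X?) u [y≔ -ₚ xₚ ] ≈ₚ 1ₚ
-- The implicit arguments are spelled out for the same reason as EvaluatesToOne is a record.
theorem4p1 n X X? u u∈ =
  EvaluatesToOne.D[x,-x]≈1 {daisyCube {n} {X} X?} {u}
    (daisyCube-evaluatesToOne {n} {X} X? {u} (∈-daisyCube⇒below {n} {X} X? {u} u∈))
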